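{- Let $H$ be a finite simple $2$-connected subcubic graph, let $e=uv\in E(H)$, and let $d$ be a real number. If $\mathrm{def}(H,e)\le d$, then $H-e$ admits a walk from $u$ to $v$ visiting every vertex of $H$, of length at most $$\frac{5n(H)+n_2(H)}{4}+d-1 .$$
   Context: A graph is subcubic if its maximum degree is at most $3$; "$2$-connected" means $2$-vertex-connected (in particular with at least $3$ vertices). $n(H)=|V(H)|$ and $n_2(H)$ is the number of degree-$2$ vertices of $H$. An even cover of $H$ is a spanning subgraph $F$ of $H$ in which every vertex has degree $0$ or $2$; its excess is $\mathrm{exc}(F)=2\cdot(\text{number of cycles of }F)+(\text{number of isolated vertices of }F)$. For an edge $e$, $\mathcal E(H,e)$ is the set of even covers of $H$ containing $e$, $\mathrm{exc}_e(H):=\min_{F\in\mathcal E(H,e)}\mathrm{exc}(F)-2$, and the rooted-excess deficit is $\mathrm{def}(H,e):=\mathrm{exc}_e(H)-\frac{n(H)+n_2(H)}{4}$. The length of a walk is its number of edges counted with repetition; walks may repeat vertices and edges. -}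

module Defs where

open import Data.Fin using (Fin)
import Data.Fin.Properties as Fin
open import Data.Integer as ℤ using (ℤ; +_)
open import Data.List using (List; []; _∷_; _∷ʳ_; allFin; filter; length; zip)
open import Data.List.Membership.Propositional using (_∈_)
open import Data.List.Relation.Unary.All using (All)
open import Data.List.Relation.Unary.Unique.Propositional using (Unique)
open import Data.Nat as ℕ using (ℕ; suc)
import Data.Nat.Properties as ℕ
open import Data.Product using (_×_; _,_; ∃-syntax; proj₁; proj₂; uncurry)
open import Data.Rational as ℚ using (ℚ; 0ℚ; ½; _/_)
import Data.Rational.Properties as ℚ
open import Data.Refinement using (Refinement-syntax; value)
open import Data.Sum using (_⊎_; inj₁; inj₂)
open import Function using (_on_; _⇔_; Inverse)
open import Function.Properties.Equivalence using (⇔-isEquivalence)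
open import Level using (0ℓ)
open import Relation.Binary using (Rel; Setoid; Symmetric; Irreflexive; Decidable; _⇒_)
open import Relation.Binary.Construct.Closure.ReflexiveTransitive using (Star; ε; _◅_)
open import Relation.Binary.PropositionalEquality
  using (_≡_; _≢_; refl; sym; cong; subst; setoid; module ≡-Reasoning)
open import Relation.Binary.Structures using (IsEquivalence)
open import Relation.Nullary using (¬_; ¬?; _×-dec_; _⊎-dec_)
open import Relation.Unary using (Pred)
import Relation.Unary as Unary

record SimpleGraph (V : Set) : Set₁ where
  field
    Adj        : Rel V 0ℓ
    adj-sym    : Symmetric Adj
    adj-irrefl : Irreflexive _≡_ Adj
    adj?       : Decidable Adj

open SimpleGraph public

Walk : ∀ {V} → SimpleGraph V → V → V → Set
Walk G = Star (Adj G)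

walkLength : ∀ {V : Set} {R : Rel V 0ℓ} {a b} → Star R a b → ℕ
walkLength ε       = 0
walkLength (_ ◅ w) = suc (walkLength w)

walkVertices : ∀ {V : Set} {R : Rel V 0ℓ} {a b} → Star R a b → List V
walkVertices {a = a} ε       = a ∷ []
walkVertices {a = a} (_ ◅ w) = a ∷ walkVertices w

Connected : ∀ {V} → SimpleGraph V → Set
Connected G = ∀ a b → Walk G a b

deleteVertex : ∀ {V} → SimpleGraph V → (x : V) → SimpleGraph [ y ∈ V ∣ y ≢ x ]
deleteVertex G x = record
  { Adj        = Adj G on value
  ; adj-sym    = adj-sym G
  ; adj-irrefl = λ y≡z → adj-irrefl G (cong value y≡z)
  ; adj?       = λ y z → adj? G (value y) (value z)
  }

SameEdge : ∀ {V : Set} → V → V → V → V → Set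
SameEdge a b u v = (a ≡ u × b ≡ v) ⊎ (a ≡ v × b ≡ u)

deleteEdge : ∀ {n} → SimpleGraph (Fin n) → Fin n → Fin n → SimpleGraph (Fin n)
deleteEdge G u v = record
  { Adj        = λ a b → Adj G a b × ¬ SameEdge a b u v
  ; adj-sym    = λ { (ab , ¬e) → adj-sym G ab , λ { (inj₁ (p , q)) → ¬e (inj₂ (q , p))
                                                  ; (inj₂ (p , q)) → ¬e (inj₁ (q , p)) } }
  ; adj-irrefl = λ a≡b ab → adj-irrefl G a≡b (proj₁ ab)
  ; adj?       = λ a b → adj? G a b ×-dec
                   ¬? ((a Fin.≟ u ×-dec b Fin.≟ v) ⊎-dec (a Fin.≟ v ×-dec b Fin.≟ u))
  }

TwoConnected : ∀ {n} → SimpleGraph (Fin n) → Set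
TwoConnected {n} G = 3 ℕ.≤ n × Connected G × (∀ x → Connected (deleteVertex G x))

count : ∀ {n} {P : Pred (Fin n) 0ℓ} → Unary.Decidable P → ℕ
count {n} P? = length (filter P? (allFin n))

degree : ∀ {n} → SimpleGraph (Fin n) → Fin n → ℕ
degree G v = count (adj? G v)

Subcubic : ∀ {n} → SimpleGraph (Fin n) → Set
Subcubic G = ∀ v → degree G v ℕ.≤ 3

#degree : ∀ {n} → ℕ → SimpleGraph (Fin n) → ℕ
#degree k G = count (λ v → degree G v ℕ.≟ k)

n₂ : ∀ {n} → SimpleGraph (Fin n) → ℕ
n₂ = #degree 2

-- A cycle is given by a cyclic enumeration x₀ x₁ … xₖ of its vertices.
-- As a subgraph it has many enumerations, which _≈ᶜ_ identifies.

record Cycle {V} (G : SimpleGraph V) : Set where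
  field
    first : V
    rest  : List V

  vertices : List V
  vertices = first ∷ rest

  -- (x₀ , x₁) , (x₁ , x₂) , … , (xₖ , x₀)
  arcs : List (V × V)
  arcs = zip vertices (rest ∷ʳ first)

  field
    distinct    : Unique vertices
    atLeast3    : 3 ℕ.≤ length vertices
    consecutive : All (uncurry (Adj G)) arcs

  Edge : Rel V 0ℓ
  Edge a b = (a , b) ∈ arcs ⊎ (b , a) ∈ arcs

_≈ᶜ_ : ∀ {V} {G : SimpleGraph V} → Rel (Cycle G) 0ℓ
C ≈ᶜ D = ∀ a b → Cycle.Edge C a b ⇔ Cycle.Edge D a b

cycleSetoid : ∀ {V} → SimpleGraph V → Setoid 0ℓ 0ℓ
cycleSetoid G = record
  { Carrier       = Cycle G
  ; _≈_           = _≈ᶜ_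
  ; isEquivalence = record
    { refl  = λ a b → ⇔.refl
    ; sym   = λ p a b → ⇔.sym (p a b)
    ; trans = λ p q a b → ⇔.trans (p a b) (q a b)
    }
  }
  where module ⇔ = IsEquivalence (⇔-isEquivalence {0ℓ})

HasCycleCount : ∀ {V} → SimpleGraph V → ℕ → Set
HasCycleCount G c = Inverse (setoid (Fin c)) (cycleSetoid G)

record EvenCover {n} (H : SimpleGraph (Fin n)) : Set₁ where
  field
    graph    : SimpleGraph (Fin n)
    subgraph : Adj graph ⇒ Adj H
    even     : ∀ v → degree graph v ≡ 0 ⊎ degree graph v ≡ 2

-- exc(F) = x.  The cycle count, and hence exc, exc_e and def, are given as
-- functional relations rather than computed values.
HasExcess : ∀ {n} → SimpleGraph (Fin n) → ℕ → Set
HasExcess F x = ∃[ c ] HasCycleCount F c × x ≡ 2 ℕ.* c ℕ.+ #degree 0 F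

IsMinimumOf : ∀ {ℓ} → ℕ → Pred ℕ ℓ → Set ℓ
IsMinimumOf m P = P m × (∀ k → P k → m ℕ.≤ k)

-- The values exc(F) for F ranging over 𝓔(H, uv).
RootedExcesses : ∀ {n} → SimpleGraph (Fin n) → Fin n → Fin n → Pred ℕ _
RootedExcesses H u v x =
  ∃[ F ] Adj (EvenCover.graph {H = H} F) u v × HasExcess (EvenCover.graph F) x

-- exc_{uv}(H) = z
HasRootedExcess : ∀ {n} → SimpleGraph (Fin n) → Fin n → Fin n → ℤ → Set₁
HasRootedExcess H u v z =
  ∃[ m ] IsMinimumOf m (RootedExcesses H u v) × z ≡ + m ℤ.- + 2

-- def(H, uv) = δ
HasDeficit : ∀ {n} → SimpleGraph (Fin n) → Fin n → Fin n → ℚ → Set₁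
HasDeficit {n} H u v δ =
  ∃[ z ] HasRootedExcess H u v z × δ ≡ z / 1 ℚ.- + (n ℕ.+ n₂ H) / 4

-- Cauchy sequences of rationals, ordered up to null sequences.
record ℝ : Set where
  field
    seq    : ℕ → ℚ
    cauchy : ∀ ϵ → 0ℚ ℚ.< ϵ →
             ∃[ N ] (∀ m n → N ℕ.≤ m → N ℕ.≤ n → ℚ.∣ seq m ℚ.- seq n ∣ ℚ.< ϵ)

open ℝ public

infix 4 _≤ᴿ_
infixl 6 _+ᴿ_

_≤ᴿ_ : Rel ℝ 0ℓ
x ≤ᴿ y = ∀ ϵ → 0ℚ ℚ.< ϵ → ∃[ N ] (∀ n → N ℕ.≤ n → seq x n ℚ.≤ seq y n ℚ.+ ϵ)

fromℚ : ℚ → ℝ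
fromℚ q = record
  { seq    = λ _ → q
  ; cauchy = λ ϵ 0<ϵ → 0 , λ _ _ _ _ →
      subst (ℚ._< ϵ) (sym (cong ℚ.∣_∣ (ℚ.+-inverseʳ q))) 0<ϵ
  }

_+ᴿ_ : ℝ → ℝ → ℝ
x +ᴿ y = record
  { seq    = λ n → seq x n ℚ.+ seq y n
  ; cauchy = λ ϵ 0<ϵ →
      let 0<ϵ/2   = half-positive 0<ϵ
          (M , p) = cauchy x (½ ℚ.* ϵ) 0<ϵ/2
          (N , q) = cauchy y (½ ℚ.* ϵ) 0<ϵ/2
      in M ℕ.⊔ N , λ m n K≤m K≤n →
         bound ϵ (seq x m) (seq y m) (seq x n) (seq y n)
           (p m n (ℕ.m⊔n≤o⇒m≤o M N K≤m) (ℕ.m⊔n≤o⇒m≤o M N K≤n))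
           (q m n (ℕ.m⊔n≤o⇒n≤o M N K≤m) (ℕ.m⊔n≤o⇒n≤o M N K≤n))
  }
  where
  half-positive : ∀ {ϵ} → 0ℚ ℚ.< ϵ → 0ℚ ℚ.< ½ ℚ.* ϵ
  half-positive = ℚ.*-monoʳ-<-pos ½

  halves : ∀ ϵ → ½ ℚ.* ϵ ℚ.+ ½ ℚ.* ϵ ≡ ϵ
  halves ϵ = begin
    ½ ℚ.* ϵ ℚ.+ ½ ℚ.* ϵ ≡⟨ ℚ.*-distribʳ-+ ϵ ½ ½ ⟨
    (½ ℚ.+ ½) ℚ.* ϵ     ≡⟨ ℚ.*-identityˡ ϵ ⟩
    ϵ                   ∎
    where open ≡-Reasoning

  rearrange : ∀ a b c d → (a ℚ.+ b) ℚ.- (c ℚ.+ d) ≡ (a ℚ.- c) ℚ.+ (b ℚ.- d)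
  rearrange = solve 4 (λ a b c d → (a :+ b) :- (c :+ d) := (a :- c) :+ (b :- d)) refl
    where open import Data.Rational.Solver using (module +-*-Solver)
          open +-*-Solver

  bound : ∀ ϵ a b c d → ℚ.∣ a ℚ.- c ∣ ℚ.< ½ ℚ.* ϵ → ℚ.∣ b ℚ.- d ∣ ℚ.< ½ ℚ.* ϵ →
          ℚ.∣ (a ℚ.+ b) ℚ.- (c ℚ.+ d) ∣ ℚ.< ϵ
  bound ϵ a b c d p q = begin-strict
    ℚ.∣ (a ℚ.+ b) ℚ.- (c ℚ.+ d) ∣           ≡⟨ cong ℚ.∣_∣ (rearrange a b c d) ⟩
    ℚ.∣ (a ℚ.- c) ℚ.+ (b ℚ.- d) ∣           ≤⟨ ℚ.∣p+q∣≤∣p∣+∣q∣ (a ℚ.- c) (b ℚ.- d) ⟩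
    ℚ.∣ a ℚ.- c ∣ ℚ.+ ℚ.∣ b ℚ.- d ∣         <⟨ ℚ.+-mono-< p q ⟩
    ½ ℚ.* ϵ ℚ.+ ½ ℚ.* ϵ                     ≡⟨ halves ϵ ⟩
    ϵ                                       ∎
    where open ℚ.≤-Reasoning

{-# OPTIONS --safe #-}
-- Start with the cycle of the even cover through uv, minus uv itself, as a walk
-- from u to v.  As long as some vertex is missing, connectivity gives an edge xy
-- with x visited and y not; insert at x the detour x → y → (the component of y
-- in the even cover, traversed once) → y → x.  A cycle D costs |D| + 2 further
-- steps and an isolated vertex costs 2 = 1 + 1, so with c cycles and i isolated
-- vertices the final length is n + 2(c − 1) + i − 1 = n + exc_e − 1.
module Submission where

open import Defs
open import Data.Empty using (⊥-elim)
open import Data.Fin using (Fin; zero; suc)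
import Data.Fin.Properties as Fin
open import Data.Nat using (ℕ; zero; suc; _+_; _*_; _≤_; z≤n; s≤s)
import Data.Nat.Properties as ℕ
open import Data.Nat.Solver using (module +-*-Solver)
open import Data.Integer as ℤ using (+_; -[1+_])
import Data.Integer.Properties as ℤ
import Data.Integer.Solver as ℤSolver
open import Data.List using (List; []; _∷_; _∷ʳ_; _++_; allFin; filter; length; lookup; zip)
open import Data.List.Properties using (length-++; length-tabulate)
open import Data.List.Membership.Propositional using (_∈_; _∉_)
open import Data.List.Membership.Propositional.Properties
  using (∈-++⁺ˡ; ∈-++⁺ʳ; ∈-++⁻; ∈-allFin; ∈-filter⁺; ∈-filter⁻; ∈-lookup)
open import Data.List.Membership.Setoid.Properties using (index-injective)
open import Data.List.Relation.Unary.All as All using (All; []; _∷_)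
open import Data.List.Relation.Unary.AllPairs using ([]; _∷_)
open import Data.List.Relation.Unary.Any using (here; there; index)
open import Data.List.Relation.Unary.Unique.Propositional using (Unique)
open import Data.List.Relation.Unary.Unique.Propositional.Properties
  using (++⁺; allFin⁺; filter⁺; Unique[x∷xs]⇒x∉xs)
open import Data.Product using (_×_; _,_; ∃-syntax; Σ-syntax; proj₁; proj₂; uncurry)
open import Data.Rational as ℚ using (ℚ; 1ℚ; _/_; -_)
import Data.Rational.Properties as ℚ
import Data.Rational.Solver as ℚSolver
open import Data.Rational.Unnormalised as ℚᵘ using (mkℚᵘ; *≡*; *≤*)
import Data.Rational.Unnormalised.Properties as ℚᵘ
open import Data.Sum using (_⊎_; inj₁; inj₂; [_,_]′)
open import Data.Unit using (⊤; tt)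
open import Function using (_∘_; Inverse; Equivalence)
open import Level using (0ℓ)
open import Relation.Binary using (Rel; Setoid)
open import Relation.Binary.Construct.Closure.ReflexiveTransitive using (Star; ε; _◅_; _◅◅_)
open import Relation.Binary.PropositionalEquality
  using (_≡_; _≢_; refl; sym; trans; cong; cong₂; subst; setoid; module ≡-Reasoning)
open import Relation.Nullary using (¬_; yes; no)
open import Relation.Unary using (Pred)
import Relation.Unary as Unary

-- Lists without repetition

module _ {A : Set} where

  Unique-lookup-injective : ∀ {xs : List A} → Unique xs →
                            ∀ {i j} → lookup xs i ≡ lookup xs j → i ≡ j
  Unique-lookup-injective (_ ∷ _)  {zero}  {zero}  _  = refl
  Unique-lookup-injective (px ∷ _) {zero}  {suc j} eq =
    ⊥-elim (All.lookup px (∈-lookup j) eq)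
  Unique-lookup-injective (px ∷ _) {suc i} {zero}  eq =
    ⊥-elim (All.lookup px (∈-lookup i) (sym eq))
  Unique-lookup-injective (_ ∷ u)  {suc i} {suc j} eq =
    cong suc (Unique-lookup-injective u eq)

  -- Pigeonhole: sending each position in `xs` to the position of its entry in `ys` is injective.
  Unique-⊆⇒length≤ : ∀ {xs ys : List A} → Unique xs → (∀ {x} → x ∈ xs → x ∈ ys) →
                     length xs ≤ length ys
  Unique-⊆⇒length≤ u sub = Fin.injective⇒≤ {f = λ i → index (sub (∈-lookup i))}
    λ eq → Unique-lookup-injective u (index-injective (setoid A) _ _ eq)

  ∉⇒Unique-∷ : ∀ {x : A} {xs} → x ∉ xs → Unique xs → Unique (x ∷ xs)
  ∉⇒Unique-∷ x∉xs u = All.tabulate (λ { y∈xs refl → x∉xs y∈xs }) ∷ u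

  ∈-∷ʳ⁻ : ∀ (xs : List A) {x y} → x ∈ xs ∷ʳ y → x ∈ y ∷ xs
  ∈-∷ʳ⁻ xs = [ there , (λ { (here eq) → here eq }) ]′ ∘ ∈-++⁻ xs

  ∈-zip⁻ : ∀ (xs ys : List A) {x y} → (x , y) ∈ zip xs ys → x ∈ xs × y ∈ ys
  ∈-zip⁻ (_ ∷ _)  (_ ∷ _)  (here refl) = here refl , here refl
  ∈-zip⁻ (_ ∷ xs) (_ ∷ ys) (there p)   =
    let (q , r) = ∈-zip⁻ xs ys p in there q , there r

  ∈-zip⁺ : ∀ {xs ys : List A} {x} → length xs ≡ length ys → x ∈ xs →
           ∃[ y ] (x , y) ∈ zip xs ys
  ∈-zip⁺ {_ ∷ _} {y ∷ _} _  (here refl) = y , here refl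
  ∈-zip⁺ {_ ∷ _} {_ ∷ _} eq (there p)   =
    let (y , q) = ∈-zip⁺ (ℕ.suc-injective eq) p in y , there q

Unique⇒length≤n : ∀ {n} {xs : List (Fin n)} → Unique xs → length xs ≤ n
Unique⇒length≤n {n} {xs} u =
  subst (length xs ≤_) (length-tabulate {n = n} (λ i → i)) (Unique-⊆⇒length≤ u (λ _ → ∈-allFin _))

-- Walks

module _ {V : Set} {R : Rel V 0ℓ} where

  start∈ : ∀ {a b} (w : Star R a b) → a ∈ walkVertices w
  start∈ ε       = here refl
  start∈ (_ ◅ _) = here refl

  end∈ : ∀ {a b} (w : Star R a b) → b ∈ walkVertices w
  end∈ ε       = here refl
  end∈ (_ ◅ w) = there (end∈ w)

  length-walkVertices : ∀ {a b} (w : Star R a b) →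
                        length (walkVertices w) ≡ suc (walkLength w)
  length-walkVertices ε       = refl
  length-walkVertices (_ ◅ w) = cong suc (length-walkVertices w)

  -- `P` is an invariant of the steps that may help justify each new step. Keeping the vertex list
  -- unchanged lets lengths and distinctness carry over.
  transport : ∀ {Q : Rel V 0ℓ} {P : Pred V 0ℓ} → (∀ {a b} → P a → R a b → Q a b × P b) →
              ∀ {a b} (w : Star R a b) → P a →
              Σ[ w′ ∈ Star Q a b ]
                walkVertices w′ ≡ walkVertices w × All P (walkVertices w)
  transport f ε       pa = ε , refl , pa ∷ []
  transport f (r ◅ w) pa with f pa r
  ... | q , pb with transport f w pb
  ... | w′ , eq , ps = q ◅ w′ , cong (_ ∷_) eq , pa ∷ ps

  length-◅◅ : ∀ {a b c} (w : Star R a b) (w′ : Star R b c) →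
              walkLength (w ◅◅ w′) ≡ walkLength w + walkLength w′
  length-◅◅ ε       _  = refl
  length-◅◅ (_ ◅ w) w′ = cong suc (length-◅◅ w w′)

  ∈-◅◅⁺ˡ : ∀ {a b c x} (w : Star R a b) (w′ : Star R b c) →
           x ∈ walkVertices w → x ∈ walkVertices (w ◅◅ w′)
  ∈-◅◅⁺ˡ ε       w′ (here refl) = start∈ w′
  ∈-◅◅⁺ˡ (_ ◅ _) w′ (here eq)   = here eq
  ∈-◅◅⁺ˡ (_ ◅ w) w′ (there p)   = there (∈-◅◅⁺ˡ w w′ p)

  ∈-◅◅⁺ʳ : ∀ {a b c x} (w : Star R a b) (w′ : Star R b c) →
           x ∈ walkVertices w′ → x ∈ walkVertices (w ◅◅ w′)
  ∈-◅◅⁺ʳ ε       w′ p = p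
  ∈-◅◅⁺ʳ (_ ◅ w) w′ p = there (∈-◅◅⁺ʳ w w′ p)

  -- The membership proof picks the occurrence of `x` at which `t` is spliced in.
  insert-closed : ∀ {a b x} (w : Star R a b) → x ∈ walkVertices w → (t : Star R x x) →
    Σ[ w′ ∈ Star R a b ] walkLength w′ ≡ walkLength w + walkLength t ×
      (∀ {z} → z ∈ walkVertices w ⊎ z ∈ walkVertices t → z ∈ walkVertices w′)
  insert-closed ε         (here refl) t = t , refl , λ
    { (inj₁ (here refl)) → end∈ t
    ; (inj₂ q)           → q }
  insert-closed w@(_ ◅ _) (here refl) t =
    t ◅◅ w , trans (length-◅◅ t w) (ℕ.+-comm (walkLength t) _) ,
    [ ∈-◅◅⁺ʳ t w , ∈-◅◅⁺ˡ t w ]′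
  insert-closed (r ◅ w)   (there p)   t with insert-closed w p t
  ... | w′ , eq , sub = r ◅ w′ , cong suc eq , λ
    { (inj₁ (here eq)) → here eq
    ; (inj₁ (there q)) → there (sub (inj₁ q))
    ; (inj₂ q)         → there (sub (inj₂ q)) }

  -- Testing the vertices in order finds the first step out of `S`; this is how connectivity enters.
  walk-crosses : ∀ {S : Pred V 0ℓ} → Unary.Decidable S → ∀ {a b} → Star R a b → S a → ¬ S b →
                 ∃[ x ] ∃[ y ] R x y × S x × ¬ S y
  walk-crosses S? ε sa ¬sb = ⊥-elim (¬sb sa)
  walk-crosses S? {a} (_◅_ {j = c} r w) sa ¬sb with S? c
  ... | yes sc = walk-crosses S? w sc ¬sb
  ... | no ¬sc = a , c , r , sa , ¬sc

-- Cycles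

module _ {V : Set} {G : SimpleGraph V} where

  length-arcs-operands : (C : Cycle G) →
    length (Cycle.vertices C) ≡ length (Cycle.rest C ∷ʳ Cycle.first C)
  length-arcs-operands C =
    sym (trans (length-++ (Cycle.rest C)) (ℕ.+-comm (length (Cycle.rest C)) 1))

  arc⇒vertices : (C : Cycle G) → ∀ {a b} → (a , b) ∈ Cycle.arcs C →
                 a ∈ Cycle.vertices C × b ∈ Cycle.vertices C
  arc⇒vertices C p =
    let (q , r) = ∈-zip⁻ _ _ p in q , ∈-∷ʳ⁻ (Cycle.rest C) r

  edge⇒vertex : (C : Cycle G) → ∀ {a b} → Cycle.Edge C a b → a ∈ Cycle.vertices C
  edge⇒vertex C = [ proj₁ ∘ arc⇒vertices C , proj₂ ∘ arc⇒vertices C ]′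

  -- Every vertex is the tail of an arc, so the edge relation determines the vertex set. This
  -- matters because a counted cycle is known only up to `_≈ᶜ_`.
  ≈ᶜ-vertices : (C D : Cycle G) → C ≈ᶜ D → ∀ {x} →
                x ∈ Cycle.vertices C → x ∈ Cycle.vertices D
  ≈ᶜ-vertices C D C≈D p =
    let (y , q) = ∈-zip⁺ (length-arcs-operands C) p
    in edge⇒vertex D (Equivalence.to (C≈D _ y) (inj₁ q))

-- Graphs on Fin n

module _ {n} (G : SimpleGraph (Fin n)) where

  -- As a set, a closed list is a union of connected components.
  Closed : Pred (List (Fin n)) 0ℓ
  Closed S = ∀ {x y} → x ∈ S → Adj G x y → y ∈ S

  neighbours : Fin n → List (Fin n)
  neighbours x = filter (adj? G x) (allFin n)

  degree0⇒¬Adj : ∀ {x y} → degree G x ≡ 0 → ¬ Adj G x y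
  degree0⇒¬Adj {x} {y} deg xy with neighbours x | ∈-filter⁺ (adj? G x) (∈-allFin y) xy
  degree0⇒¬Adj () xy | _ ∷ _ | _

  two-neighbours : ∀ {x} → degree G x ≡ 2 →
    ∃[ a ] ∃[ b ] a ≢ b × Adj G x a × Adj G x b × (∀ {t} → Adj G x t → t ≡ a ⊎ t ≡ b)
  two-neighbours {x} deg with neighbours x in eq
                            | filter⁺ (adj? G x) (allFin⁺ n)
  two-neighbours {x} () | [] | _
  two-neighbours {x} () | _ ∷ [] | _
  two-neighbours {x} deg | a ∷ b ∷ [] | (a≢b ∷ []) ∷ _ =
    a , b , a≢b , adj (here refl) , adj (there (here refl)) , one
    where
    adj : ∀ {t} → t ∈ a ∷ b ∷ [] → Adj G x t
    adj {t} t∈ = proj₂ (∈-filter⁻ (adj? G x) {xs = allFin n} (subst (t ∈_) (sym eq) t∈))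
    one : ∀ {t} → Adj G x t → t ≡ a ⊎ t ≡ b
    one {t} xt with subst (t ∈_) eq (∈-filter⁺ (adj? G x) (∈-allFin t) xt)
    ... | here p         = inj₁ p
    ... | there (here p) = inj₂ p

  module _ {x q} (deg : degree G x ≡ 2) (xq : Adj G x q) where

    other-neighbour : ∃[ r ] r ≢ q × Adj G x r
    other-neighbour with two-neighbours deg
    ... | a , b , a≢b , xa , xb , one with one xq
    ... | inj₁ refl = b , a≢b ∘ sym , xb
    ... | inj₂ refl = a , a≢b , xa

    no-third-neighbour : ∀ {r} → r ≢ q → Adj G x r → ∀ {t} → Adj G x t → t ≡ q ⊎ t ≡ r
    no-third-neighbour r≢q xr xt with two-neighbours deg
    ... | a , b , _ , _ , _ , one with one xq | one xr | one xt
    ... | inj₁ refl | inj₁ refl | _         = ⊥-elim (r≢q refl)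
    ... | inj₂ refl | inj₂ refl | _         = ⊥-elim (r≢q refl)
    ... | inj₁ refl | inj₂ refl | inj₁ refl = inj₁ refl
    ... | inj₁ refl | inj₂ refl | inj₂ refl = inj₂ refl
    ... | inj₂ refl | inj₁ refl | inj₁ refl = inj₂ refl
    ... | inj₂ refl | inj₁ refl | inj₂ refl = inj₁ refl

  path-consecutive : ∀ {R : Rel (Fin n) 0ℓ} → (∀ {x y} → R x y → Adj G x y) →
    ∀ {a p b c} → Adj G a p → (w : Star R p b) → Adj G b c →
    All (uncurry (Adj G)) (zip (a ∷ walkVertices w) (walkVertices w ∷ʳ c))
  path-consecutive R⇒ ap ε       bc = ap ∷ bc ∷ []
  path-consecutive R⇒ ap (r ◅ w) bc = ap ∷ path-consecutive R⇒ (R⇒ r) w bc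

  -- The edge ab closes the path. As the walk itself avoids ab, it has at least two steps, which
  -- gives the three vertices a cycle requires.
  path⇒cycle : ∀ {a b} → Adj G a b → (w : Walk (deleteEdge G a b) a b) →
               Unique (walkVertices w) →
               ∃[ C ] Cycle.vertices {G = G} C ≡ walkVertices w
  path⇒cycle ab ε _ = ⊥-elim (adj-irrefl G refl ab)
  path⇒cycle ab ((_ , ¬e) ◅ ε) _ = ⊥-elim (¬e (inj₁ (refl , refl)))
  path⇒cycle {a} ab (e ◅ w@(_ ◅ w′)) u = record
    { first       = a
    ; rest        = walkVertices w
    ; distinct    = u
    ; atLeast3    = subst (λ k → 3 ≤ 2 + k) (sym (length-walkVertices w′)) (s≤s (s≤s (s≤s z≤n)))
    ; consecutive = path-consecutive proj₁ (proj₁ e) w (adj-sym G ab)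
    } , refl

-- Components of graphs with all degrees 0 or 2

module _ {n} (F : SimpleGraph (Fin n)) (even : ∀ x → degree F x ≡ 0 ⊎ degree F x ≡ 2) where

  Adj⇒degree2 : ∀ {x y} → Adj F x y → degree F x ≡ 2
  Adj⇒degree2 {x} xy with even x
  ... | inj₁ deg = ⊥-elim (degree0⇒¬Adj F deg xy)
  ... | inj₂ deg = deg

  module _ {u v} (uv : Adj F u v) where

    private
      u≢v : u ≢ v
      u≢v eq = adj-irrefl F eq uv

    -- The cycle of `F` through uv with that edge removed, as a path. Closedness makes its vertices
    -- a whole component of `F`.
    ComponentPath : Set
    ComponentPath = Σ[ w ∈ Walk (deleteEdge F u v) u v ]
                      Unique (walkVertices w) × Closed F (walkVertices w)

    -- The path p ◅ w is grown at p.  Of the vertices of w only its start q can be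
    -- adjacent to something outside w other than u, namely to p; t is the second
    -- neighbour of q.
    trace : ∀ k {p q} (pq : Adj (deleteEdge F u v) p q) (w : Walk (deleteEdge F u v) q v) →
      n ≤ k + length (walkVertices w) → Unique (p ∷ walkVertices w) →
      (∀ {z s} → z ∈ walkVertices w → z ≢ q → Adj F z s → s ≡ u ⊎ s ∈ walkVertices w) →
      ∀ {t} → t ≢ p → Adj F q t → t ≡ u ⊎ t ∈ walkVertices w →
      ComponentPath
    -- The fuel bounds the number of vertices off `w`. Here `w` would already have `n` vertices, yet
    -- `p` is one more.
    trace zero pq w fuel uniq inner t≢p qt t∈ =
      ⊥-elim (ℕ.<-irrefl refl (ℕ.≤-trans (Unique⇒length≤n uniq) fuel))
    trace (suc k) {p} {q} pq w fuel uniq inner {t} t≢p qt t∈ = extend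
      where
      p∉w : p ∉ walkVertices w
      p∉w = Unique[x∷xs]⇒x∉xs uniq

      saturated : ∀ {z s} → z ∈ walkVertices w → Adj F z s → s ≡ u ⊎ s ∈ p ∷ walkVertices w
      saturated {z} z∈ zs with z Fin.≟ q
      ... | no z≢q = [ inj₁ , inj₂ ∘ there ]′ (inner z∈ z≢q zs)
      ... | yes refl with no-third-neighbour F (Adj⇒degree2 zs) (adj-sym F (proj₁ pq)) t≢p qt zs
      ...   | inj₁ refl = inj₂ (here refl)
      ...   | inj₂ refl = [ inj₁ , inj₂ ∘ there ]′ t∈

      extend : ComponentPath
      extend with p Fin.≟ u
      -- The path has reached `u`. Both neighbours of `u` lie on `w`, namely `q` at its start and
      -- `v` at its end; they differ because the step from `p` to `q` is not uv.
      extend | yes refl = pq ◅ w , uniq , closed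
        where
        q≢v : q ≢ v
        q≢v q≡v = proj₂ pq (inj₁ (refl , q≡v))
        closed : Closed F (p ∷ walkVertices w)
        closed (here refl) xy =
          [ (λ { refl → there (start∈ w) }) , (λ { refl → there (end∈ w) }) ]′
            (no-third-neighbour F (Adj⇒degree2 xy) (proj₁ pq) (q≢v ∘ sym) uv xy)
        closed (there x∈) xy = [ here , (λ i → i) ]′ (saturated x∈ xy)
      extend | no p≢u with other-neighbour F (Adj⇒degree2 (proj₁ pq)) (proj₁ pq)
      ... | r , r≢q , pr =
        trace k rp (pq ◅ w) (subst (n ≤_) (sym (ℕ.+-suc k _)) fuel)
          (∉⇒Unique-∷ r∉ uniq)
          (λ { (here eq) z≢p _ → ⊥-elim (z≢p eq)
             ; (there z∈) _ zs → saturated z∈ zs })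
          (r≢q ∘ sym) (proj₁ pq) (inj₂ (there (start∈ w)))
        where
        rp : Adj (deleteEdge F u v) r p
        rp = adj-sym F pr , λ
          { (inj₁ (_ , refl)) → p∉w (end∈ w)
          ; (inj₂ (_ , p≡u))  → p≢u p≡u }
        r∉ : r ∉ p ∷ walkVertices w
        r∉ (here refl) = adj-irrefl F refl pr
        -- A vertex of `w` other than `q` has all its neighbours in `w` or equal to `u`; `p` is
        -- neither.
        r∉ (there r∈)  = [ p≢u , p∉w ]′ (inner r∈ r≢q (adj-sym F pr))

    componentPath : ComponentPath
    componentPath with other-neighbour F (Adj⇒degree2 (adj-sym F uv)) (adj-sym F uv)
    ... | x , x≢u , vx =
      -- The one-vertex path at `v` has `q = v` with second neighbour `u`, which is not on the path:
      -- hence the alternative `t ≡ u` in `trace`.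
      trace n xv ε (ℕ.m≤m+n n 1)
        (∉⇒Unique-∷ (λ { (here refl) → adj-irrefl F refl vx }) ([] ∷ []))
        (λ { (here eq) z≢v _ → ⊥-elim (z≢v eq) })
        (x≢u ∘ sym) (adj-sym F uv) (inj₁ refl)
      where
      xv : Adj (deleteEdge F u v) x v
      xv = adj-sym F vx , λ
        { (inj₁ (x≡u , _)) → x≢u x≡u
        ; (inj₂ (_ , v≡u)) → u≢v (sym v≡u) }

-- The exploration

module _ {n} (H : SimpleGraph (Fin n)) (connected : Connected H) (E : EvenCover H)
         {u v} (uv : Adj (EvenCover.graph E) u v)
         {c} (cycles : HasCycleCount (EvenCover.graph E) c) where

  open EvenCover E using (even; subgraph) renaming (graph to F)
  open import Data.List.Membership.DecPropositional (Fin._≟_ {n}) using (_∈?_)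

  private
    H-e : SimpleGraph (Fin n)
    H-e = deleteEdge H u v

    cycleAt : Fin c → Cycle F
    cycleAt = Inverse.to cycles

    indexOf : Cycle F → Fin c
    indexOf = Inverse.from cycles

    cycleAt-indexOf : ∀ C → cycleAt (indexOf C) ≈ᶜ C
    cycleAt-indexOf = Inverse.strictlyInverseˡ cycles

  -- `visited` lists vertices once each and forms a union of components of `F`. `indices` and
  -- `isolated` record the components met; cycles are recorded by number since `HasCycleCount`
  -- counts classes of enumerations.
  record Exploration : Set where
    field
      walk           : Walk H-e u v
      visited        : List (Fin n)
      visited-unique : Unique visited
      visited-closed : Closed F visited
      visited⊆walk   : ∀ {x} → x ∈ visited → x ∈ walkVertices walk
      u∈visited      : u ∈ visited
      v∈visited      : v ∈ visited
      indices        : List (Fin c)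
      indices-unique : Unique indices
      indices⊆       : ∀ {k} → k ∈ indices →
                       ∀ {x} → x ∈ Cycle.vertices (cycleAt k) → x ∈ visited
      isolated        : List (Fin n)
      isolated-unique : Unique isolated
      isolated⊆       : ∀ {x} → x ∈ isolated → x ∈ visited
      isolated-degree : ∀ {x} → x ∈ isolated → degree F x ≡ 0
      -- A first cycle on s vertices gives a path of s - 1 = s + 2 - 3 steps; the 3 is added on the
      -- left to avoid subtraction.
      length-walk     : walkLength walk + 3 ≡
                        length visited + 2 * length indices + length isolated

  open Exploration

  start : Exploration
  start with componentPath F even uv
  ... | w , uniq , closed
      with path⇒cycle F uv w uniq
         | transport {Q = Adj H-e} {P = λ _ → ⊤} (λ _ (xy , ¬e) → (subgraph xy , ¬e) , tt) w tt
  ... | C , C≡w | w′ , w′≡w , _ = record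
    { walk           = w′
    ; visited        = walkVertices w
    ; visited-unique = uniq
    ; visited-closed = closed
    ; visited⊆walk   = subst (_ ∈_) (sym w′≡w)
    ; u∈visited      = start∈ w
    ; v∈visited      = end∈ w
    ; indices        = indexOf C ∷ []
    ; indices-unique = [] ∷ []
    ; indices⊆       = λ { (here refl) x∈ →
        subst (_ ∈_) C≡w (≈ᶜ-vertices (cycleAt (indexOf C)) C (cycleAt-indexOf C) x∈) }
    ; isolated        = []
    ; isolated-unique = []
    ; isolated⊆       = λ ()
    ; isolated-degree = λ ()
    ; length-walk     = begin
        walkLength w′ + 3
          ≡⟨ solve 1 (λ l → l :+ con 3 := (con 1 :+ l) :+ con 2 :+ con 0) refl (walkLength w′) ⟩
        suc (walkLength w′) + 2 + 0
          ≡⟨ cong (λ l → l + 2 + 0)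
               (trans (sym (length-walkVertices w′)) (cong length w′≡w)) ⟩
        length (walkVertices w) + 2 + 0 ∎
    }
    where
    open ≡-Reasoning
    open +-*-Solver

  -- Detours to one new component of the even cover

  module _ (X : Exploration) {x y} (xy : Adj H x y) (x∈ : x ∈ visited X) (y∉ : y ∉ visited X) where

    private
      S = visited X

      -- Both ends of uv are visited from the start, so an edge with an unvisited end is never uv.
      outside-edge : ∀ {a b} → Adj H a b → b ∉ S → Adj H-e a b
      outside-edge ab b∉ = ab , λ
        { (inj₁ (_ , refl)) → b∉ (v∈visited X)
        ; (inj₂ (_ , refl)) → b∉ (u∈visited X) }

      -- `visited` is closed under the symmetric adjacency of `F`, so no edge of `F` enters it from
      -- outside.
      outside-step : ∀ {a b} → a ∉ S → Adj F a b → Adj H-e a b × b ∉ S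
      outside-step a∉ ab = outside-edge (subgraph ab) b∉ , b∉
        where b∉ = λ b∈ → a∉ (visited-closed X b∈ (adj-sym F ab))

      -- The edge xy is used out and back, which accounts for the 2.
      insert-detour : (t : Walk H-e y y) →
        Σ[ w ∈ Walk H-e u v ] walkLength w ≡ walkLength (walk X) + (2 + walkLength t) ×
          (∀ {z} → z ∈ S ⊎ z ∈ walkVertices t → z ∈ walkVertices w)
      insert-detour t =
        let xy′ = outside-edge xy y∉
            t′  = t ◅◅ (adj-sym H-e xy′ ◅ ε)
            (w , eq , sub) = insert-closed (walk X) (visited⊆walk X x∈) (xy′ ◅ t′)
        in w
         , trans eq (cong (λ l → walkLength (walk X) + suc l)
                      (trans (length-◅◅ t _) (ℕ.+-comm (walkLength t) 1)))
         , λ { (inj₁ z∈) → sub (inj₁ (visited⊆walk X z∈))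
             ; (inj₂ z∈) → sub (inj₂ (there (∈-◅◅⁺ˡ t _ z∈))) }

    visit-isolated : degree F y ≡ 0 →
                     ∃[ X′ ] length (visited X′) ≡ suc (length (visited X))
    visit-isolated deg with insert-detour ε
    ... | w , len , sub = record
      { walk           = w
      ; visited        = y ∷ S
      ; visited-unique = ∉⇒Unique-∷ y∉ (visited-unique X)
      ; visited-closed = λ { (here refl) ab → ⊥-elim (degree0⇒¬Adj F deg ab)
                           ; (there a∈) ab → there (visited-closed X a∈ ab) }
      ; visited⊆walk   = λ { (here eq) → sub (inj₂ (here eq))
                           ; (there z∈) → sub (inj₁ z∈) }
      ; u∈visited      = there (u∈visited X)
      ; v∈visited      = there (v∈visited X)
      ; indices        = indices X
      ; indices-unique = indices-unique X
      ; indices⊆       = λ k∈ z∈ → there (indices⊆ X k∈ z∈)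
      ; isolated        = y ∷ isolated X
      ; isolated-unique = ∉⇒Unique-∷ (y∉ ∘ isolated⊆ X) (isolated-unique X)
      ; isolated⊆       = λ { (here eq) → here eq ; (there z∈) → there (isolated⊆ X z∈) }
      ; isolated-degree = λ { (here refl) → deg ; (there z∈) → isolated-degree X z∈ }
      ; length-walk     = begin
          walkLength w + 3
            ≡⟨ cong (_+ 3) len ⟩
          walkLength (walk X) + 2 + 3
            ≡⟨ solve 1 (λ l → l :+ con 2 :+ con 3 := l :+ con 3 :+ con 2) refl
                 (walkLength (walk X)) ⟩
          walkLength (walk X) + 3 + 2
            ≡⟨ cong (_+ 2) (length-walk X) ⟩
          length S + 2 * length (indices X) + length (isolated X) + 2
            ≡⟨ solve 3 (λ s k i → s :+ con 2 :* k :+ i :+ con 2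
                                := con 1 :+ s :+ con 2 :* k :+ (con 1 :+ i)) refl
                 (length S) (length (indices X)) (length (isolated X)) ⟩
          suc (length S) + 2 * length (indices X) + suc (length (isolated X)) ∎
      } , refl
      where
      open ≡-Reasoning
      open +-*-Solver

    visit-cycle : ∀ {z} → Adj F y z →
                  ∃[ X′ ] ∃[ k ] length (visited X′) ≡ suc k + length (visited X)
    visit-cycle {z} yz with componentPath F even yz
    ... | p , uniq , closed
        with path⇒cycle F yz p uniq
           -- Being unvisited is the invariant: it makes every step valid in `H-e` and keeps the new
           -- component disjoint from `S`.
           | transport (λ a∉ ab → outside-step a∉ (proj₁ ab)) p y∉
    ... | C , C≡p | p′ , p′≡p , outside
        -- The removed edge, taken from `z` back to `y`, closes the path into a tour of the cycle
        -- with as many steps as vertices.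
        with insert-detour (p′ ◅◅ (adj-sym H-e (proj₁ (outside-step y∉ yz)) ◅ ε))
    ... | w , len , sub = record
      { walk           = w
      ; visited        = D ++ S
      ; visited-unique = ++⁺ uniq (visited-unique X) λ (a∈D , a∈S) → All.lookup outside a∈D a∈S
      ; visited-closed = λ a∈ ab →
          [ (λ a∈D → ∈-++⁺ˡ (closed a∈D ab)) , (λ a∈S → ∈-++⁺ʳ D (visited-closed X a∈S ab)) ]′
            (∈-++⁻ D a∈)
      ; visited⊆walk   = λ a∈ →
          [ (λ a∈D → sub (inj₂ (∈-◅◅⁺ˡ p′ _ (subst (_ ∈_) (sym p′≡p) a∈D)))) , sub ∘ inj₁ ]′
            (∈-++⁻ D a∈)
      ; u∈visited      = ∈-++⁺ʳ D (u∈visited X)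
      ; v∈visited      = ∈-++⁺ʳ D (v∈visited X)
      ; indices        = indexOf C ∷ indices X
      ; indices-unique = ∉⇒Unique-∷ new-index (indices-unique X)
      ; indices⊆       = λ
          { (here refl) a∈ → ∈-++⁺ˡ (subst (_ ∈_) C≡p
              (≈ᶜ-vertices (cycleAt (indexOf C)) C (cycleAt-indexOf C) a∈))
          ; (there k∈) a∈ → ∈-++⁺ʳ D (indices⊆ X k∈ a∈) }
      ; isolated        = isolated X
      ; isolated-unique = isolated-unique X
      ; isolated⊆       = ∈-++⁺ʳ D ∘ isolated⊆ X
      ; isolated-degree = isolated-degree X
      ; length-walk     = begin
          walkLength w + 3
            ≡⟨ cong (_+ 3) (trans len (cong (λ l → walkLength (walk X) + (2 + l))
                 (length-◅◅ p′ _))) ⟩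
          walkLength (walk X) + (2 + (walkLength p′ + 1)) + 3
            ≡⟨ solve 2 (λ l d → l :+ (con 2 :+ (d :+ con 1)) :+ con 3
                              := (l :+ con 3) :+ (con 1 :+ d :+ con 2)) refl
                 (walkLength (walk X)) (walkLength p′) ⟩
          walkLength (walk X) + 3 + (suc (walkLength p′) + 2)
            ≡⟨ cong₂ (λ a b → a + (b + 2)) (length-walk X)
                 (trans (sym (length-walkVertices p′)) (cong length p′≡p)) ⟩
          length S + 2 * length (indices X) + length (isolated X) + (length D + 2)
            ≡⟨ solve 4 (λ s k i d → s :+ con 2 :* k :+ i :+ (d :+ con 2)
                                  := d :+ s :+ con 2 :* (con 1 :+ k) :+ i) refl
                 (length S) (length (indices X)) (length (isolated X)) (length D) ⟩
          length D + length S + 2 * suc (length (indices X)) + length (isolated X)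
            ≡⟨ cong (λ a → a + 2 * suc (length (indices X)) + length (isolated X))
                 (length-++ D) ⟨
          length (D ++ S) + 2 * suc (length (indices X)) + length (isolated X) ∎
      } , walkLength p , trans (length-++ D) (cong (_+ length S) (length-walkVertices p))
      where
      open ≡-Reasoning
      open +-*-Solver
      D = walkVertices p
      -- Had this cycle been counted before, all its vertices, `y` among them, would be visited
      -- already.
      new-index : indexOf C ∉ indices X
      new-index k∈ = y∉ (indices⊆ X k∈
        (≈ᶜ-vertices C (cycleAt (indexOf C))
          (Setoid.sym (cycleSetoid F) {cycleAt (indexOf C)} {C} (cycleAt-indexOf C))
          (subst (y ∈_) (sym C≡p) (start∈ p))))

    visit : ∃[ X′ ] ∃[ k ] length (visited X′) ≡ suc k + length (visited X)
    visit with even y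
    ... | inj₁ deg = let (X′ , eq) = visit-isolated deg in X′ , 0 , eq
    ... | inj₂ deg = let (_ , _ , _ , yz , _) = two-neighbours F deg in visit-cycle yz

  -- The fuel `k` bounds the number of unvisited vertices, and each visit gains at least one. With
  -- no fuel left, a further `y` would make more than `n` distinct vertices.
  explore : ∀ k (X : Exploration) → n ≤ k + length (visited X) →
            ∃[ X′ ] (∀ x → x ∈ visited X′)
  explore k X fuel with Fin.all? (_∈? visited X)
  ... | yes all = X , all
  ... | no ¬all with Fin.¬∀⟶∃¬ n _ (_∈? visited X) ¬all
  -- The walk from `u` to `b` lives in `H` and may use uv, but the step where it leaves `visited`
  -- has an unvisited end and so is not uv.
  ... | b , b∉ with walk-crosses (_∈? visited X) (connected u b) (u∈visited X) b∉
  ... | x , y , xy , x∈ , y∉ with k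
  ...   | zero = ⊥-elim (ℕ.<-irrefl refl
            (ℕ.≤-trans (Unique⇒length≤n (∉⇒Unique-∷ y∉ (visited-unique X))) fuel))
  ...   | suc k with visit X xy x∈ y∉
  ...     | X′ , j , eq = explore k X′ (subst (λ l → n ≤ k + l) (sym eq)
              (ℕ.≤-trans fuel (ℕ.≤-trans (ℕ.≤-reflexive (sym (ℕ.+-suc k _)))
                (ℕ.+-monoʳ-≤ k (s≤s (ℕ.m≤n+m _ j))))))

  spanning-walk : Σ[ w ∈ Walk H-e u v ]
    (∀ x → x ∈ walkVertices w) × walkLength w + 3 ≤ n + (2 * c + #degree 0 F)
  spanning-walk with explore n start (ℕ.m≤m+n n _)
  ... | X , all = walk X , (λ x → visited⊆walk X (all x)) , (begin
    walkLength (walk X) + 3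
      ≡⟨ length-walk X ⟩
    length (visited X) + 2 * length (indices X) + length (isolated X)
      ≡⟨ ℕ.+-assoc (length (visited X)) _ _ ⟩
    length (visited X) + (2 * length (indices X) + length (isolated X))
      -- All three lists are free of repetition: the visited vertices lie in `Fin n`, the indices in
      -- `Fin c`, the isolated vertices among those of degree 0.
      ≤⟨ ℕ.+-mono-≤ (Unique⇒length≤n (visited-unique X))
           (ℕ.+-mono-≤ (ℕ.*-monoʳ-≤ 2 (Unique⇒length≤n (indices-unique X)))
             (Unique-⊆⇒length≤ (isolated-unique X) λ x∈ →
               ∈-filter⁺ (λ x → degree F x ℕ.≟ 0) (∈-allFin _) (isolated-degree X x∈))) ⟩
    n + (2 * c + #degree 0 F) ∎)
    where open ℕ.≤-Reasoning

-- Rational arithmetic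

-- Since `fromℚᵘ (mkℚᵘ i k)` is `i / suc k`, this lets sums of fractions be computed on unnormalised
-- representatives.
fromℚᵘ-homo-+ : ∀ p q → ℚ.fromℚᵘ (p ℚᵘ.+ q) ≡ ℚ.fromℚᵘ p ℚ.+ ℚ.fromℚᵘ q
fromℚᵘ-homo-+ p q = ℚ.toℚᵘ-injective (begin
  ℚ.toℚᵘ (ℚ.fromℚᵘ (p ℚᵘ.+ q))
    ≈⟨ ℚ.toℚᵘ-fromℚᵘ (p ℚᵘ.+ q) ⟩
  p ℚᵘ.+ q
    ≈⟨ ℚᵘ.+-cong (ℚ.toℚᵘ-fromℚᵘ p) (ℚ.toℚᵘ-fromℚᵘ q) ⟨
  ℚ.toℚᵘ (ℚ.fromℚᵘ p) ℚᵘ.+ ℚ.toℚᵘ (ℚ.fromℚᵘ q)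
    ≈⟨ ℚ.toℚᵘ-homo-+ (ℚ.fromℚᵘ p) (ℚ.fromℚᵘ q) ⟨
  ℚ.toℚᵘ (ℚ.fromℚᵘ p ℚ.+ ℚ.fromℚᵘ q) ∎)
  where open import Relation.Binary.Reasoning.Setoid ℚᵘ.≃-setoid

/1-homo-+ : ∀ i j → (i ℤ.+ j) / 1 ≡ i / 1 ℚ.+ j / 1
/1-homo-+ i j = trans
  (cong (_/ 1) (sym (cong₂ ℤ._+_ (ℤ.*-identityʳ i) (ℤ.*-identityʳ j))))
  (fromℚᵘ-homo-+ (mkℚᵘ i 0) (mkℚᵘ j 0))

/1-mono-≤ : ∀ {i j} → i ℤ.≤ j → i / 1 ℚ.≤ j / 1
/1-mono-≤ {i} {j} i≤j = ℚ.toℚᵘ-cancel-≤ (begin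
  ℚ.toℚᵘ (i / 1) ≃⟨ ℚ.toℚᵘ-fromℚᵘ (mkℚᵘ i 0) ⟩
  mkℚᵘ i 0       ≤⟨ *≤* (ℤ.*-monoʳ-≤-nonNeg (+ 1) i≤j) ⟩
  mkℚᵘ j 0       ≃⟨ ℚ.toℚᵘ-fromℚᵘ (mkℚᵘ j 0) ⟨
  ℚ.toℚᵘ (j / 1) ∎)
  where open ℚᵘ.≤-Reasoning

-- Splits off the quarter that the deficit subtracts, so that the two cancel in `length-bound`.
quarters : ∀ n k → + (5 * n + k) / 4 ≡ + n / 1 ℚ.+ + (n + k) / 4
quarters n k = trans
  (ℚ.fromℚᵘ-cong {mkℚᵘ (+ (5 * n + k)) 3} {mkℚᵘ (+ n) 0 ℚᵘ.+ mkℚᵘ (+ (n + k)) 3}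
    (*≡* (begin
      + (5 * n + k) ℤ.* + 4
        ≡⟨ cong (ℤ._* + 4) (cong +_ (solve 2 (λ n k → con 5 :* n :+ k
             := n :* con 4 :+ (n :+ k) :* con 1) refl n k)) ⟩
      + (n * 4 + (n + k) * 1) ℤ.* + 4
        ≡⟨ cong (ℤ._* + 4) (cong₂ ℤ._+_ (ℤ.pos-* n 4) (ℤ.pos-* (n + k) 1)) ⟩
      (+ n ℤ.* + 4 ℤ.+ + (n + k) ℤ.* + 1) ℤ.* + 4 ∎)))
  (fromℚᵘ-homo-+ (mkℚᵘ (+ n) 0) (mkℚᵘ (+ (n + k)) 3))
  where
  open ≡-Reasoning
  open +-*-Solver

-- With z = m - 2, the hypothesis gives l ≤ n + m - 3 = n + z - 1, and n + z is (5n + k)/4 + δ.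
length-bound : ∀ l m n k → l + 3 ≤ n + m →
               ∀ {z δ} → z ≡ + m ℤ.- + 2 → δ ≡ z / 1 ℚ.- + (n + k) / 4 →
               + l / 1 ℚ.≤ + (5 * n + k) / 4 ℚ.+ δ ℚ.+ - 1ℚ
length-bound l m n k l+3≤n+m {z} refl refl = begin
  + l / 1
    ≤⟨ /1-mono-≤ integer-bound ⟩
  (+ n ℤ.+ z ℤ.+ -[1+ 0 ]) / 1
    ≡⟨ /1-homo-+ (+ n ℤ.+ z) -[1+ 0 ] ⟩
  (+ n ℤ.+ z) / 1 ℚ.+ - 1ℚ
    ≡⟨ cong (ℚ._+ - 1ℚ) (/1-homo-+ (+ n) z) ⟩
  + n / 1 ℚ.+ z / 1 ℚ.+ - 1ℚ
    ≡⟨ solve 4 (λ a b s o → a :+ b :+ o := (a :+ s) :+ (b :- s) :+ o) refl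
         (+ n / 1) (z / 1) (+ (n + k) / 4) (- 1ℚ) ⟩
  (+ n / 1 ℚ.+ + (n + k) / 4) ℚ.+ (z / 1 ℚ.- + (n + k) / 4) ℚ.+ - 1ℚ
    ≡⟨ cong (λ a → a ℚ.+ (z / 1 ℚ.- + (n + k) / 4) ℚ.+ - 1ℚ) (quarters n k) ⟨
  + (5 * n + k) / 4 ℚ.+ (z / 1 ℚ.- + (n + k) / 4) ℚ.+ - 1ℚ ∎
  where
  open ℚ.≤-Reasoning
  open ℚSolver.+-*-Solver
  integer-bound : + l ℤ.≤ + n ℤ.+ z ℤ.+ -[1+ 0 ]
  integer-bound = I.begin
    + l                        I.≡⟨ S.solve 1 (λ l → l S.:= (l S.:+ S.con (+ 3)) S.:- S.con (+ 3))
                                     refl (+ l) ⟩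
    (+ l ℤ.+ + 3) ℤ.- + 3      I.≤⟨ ℤ.+-monoˡ-≤ (ℤ.- + 3) (ℤ.+≤+ l+3≤n+m) ⟩
    (+ n ℤ.+ + m) ℤ.- + 3      I.≡⟨ S.solve 2 (λ n m → (n S.:+ m) S.:- S.con (+ 3)
                                       S.:= n S.:+ (m S.:- S.con (+ 2)) S.:+ S.con -[1+ 0 ])
                                     refl (+ n) (+ m) ⟩
    + n ℤ.+ z ℤ.+ -[1+ 0 ]     I.∎
    where
    module I = ℤ.≤-Reasoning
    module S = ℤSolver.+-*-Solver

-- For each `ϵ`, the index `N` supplied by `fromℚ δ ≤ᴿ d` also serves the conclusion: replacing `δ`
-- by `seq d k + ϵ` leaves the same error `ϵ`.
≤ᴿ-by-approximation : ∀ l a {δ} → l ℚ.≤ a ℚ.+ δ ℚ.+ - 1ℚ → ∀ d → fromℚ δ ≤ᴿ d →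
          fromℚ l ≤ᴿ fromℚ a +ᴿ d +ᴿ fromℚ (- 1ℚ)
≤ᴿ-by-approximation l a {δ} l≤ d δ≤d ϵ 0<ϵ = let (N , p) = δ≤d ϵ 0<ϵ in N , λ k N≤k → begin
  l
    ≤⟨ l≤ ⟩
  a ℚ.+ δ ℚ.+ - 1ℚ
    ≤⟨ ℚ.+-monoˡ-≤ (- 1ℚ) (ℚ.+-monoʳ-≤ a (p k N≤k)) ⟩
  a ℚ.+ (seq d k ℚ.+ ϵ) ℚ.+ - 1ℚ
    ≡⟨ solve 4 (λ a d e o → a :+ (d :+ e) :+ o := a :+ d :+ o :+ e) refl
         a (seq d k) ϵ (- 1ℚ) ⟩
  a ℚ.+ seq d k ℚ.+ - 1ℚ ℚ.+ ϵ ∎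
  where
  open ℚ.≤-Reasoning
  open ℚSolver.+-*-Solver

lemma8 : ∀ {n} (H : SimpleGraph (Fin n)) → TwoConnected H → Subcubic H →
    ∀ u v → Adj H u v →
    ∀ (d : ℝ) (δ : ℚ) → HasDeficit H u v δ → fromℚ δ ≤ᴿ d →
    Σ[ w ∈ Walk (deleteEdge H u v) u v ]
    (∀ x → x ∈ walkVertices w) ×
    fromℚ (+ walkLength w / 1)
    ≤ᴿ fromℚ (+ (5 * n + n₂ H) / 4) +ᴿ d +ᴿ fromℚ (- 1ℚ)
lemma8 {n} H (_ , connected , _) _ u v _ d δ
  (_ , (m , ((E , uv , c , cycles , m≡) , _) , z≡) , δ≡) δ≤d =
  -- The minimum `m` is attained by a cover `E` through uv, and the walk is built from that cover.
  let (w , spans , short) = spanning-walk H connected E uv cycles in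
  w , spans ,
  ≤ᴿ-by-approximation (+ walkLength w / 1) (+ (5 * n + n₂ H) / 4)
    (length-bound (walkLength w) m n (n₂ H)
       (subst (λ k → walkLength w + 3 ≤ n + k) (sym m≡) short) z≡ δ≡)
    d δ≤d
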